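{- Let $n\geq 1$ be an integer. The number of binary bits required to represent $\binom{2^n}{2^{n-1}}$ is $2^n-\lfloor n/2\rfloor$.
   Context: The number of binary bits required to represent a positive integer $m$ is the number of digits in its base-2 expansion, i.e., $\lfloor \log_2 m\rfloor+1$. -}

module Defs where

open import Data.Bool.Base using (Bool; true; false)
open import Data.Digit using (toNatDigits)
open import Data.List.Base using (List; []; _∷_; length)
open import Data.Nat.Base
  using (ℕ; zero; suc; _+_; _/_; _%_; _≤_; _<_; _<ᵇ_; z≤n; s≤s; sz<ss; ⌊_/2⌋)
open import Data.Nat.DivMod using (m/n<m; m/n≡1+[m∸n]/n)
open import Data.Nat.Induction using (Acc; acc; <-wellFounded-fast)
open import Data.Nat.Logarithm using (⌊log₂_⌋)
open import Data.Nat.Logarithm.Core using (⌊log2⌋-acc-irrelevant)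
open import Data.Nat.Properties using (_<?_; +-suc)
open import Induction.WellFounded using (acc-inverse)
open import Relation.Binary.PropositionalEquality using (_≡_; refl; sym; trans; cong)
open import Relation.Nullary.Decidable using (does)

-- toNatDigits produces no leading zeros (except for m = 0, whose expansion is
-- 0 ∷ []), so this is the ⌊log₂ m⌋ + 1 of numBits≡⌊log₂⌋+1.
numBits : ℕ → ℕ
numBits m = length (toNatDigits 2 m)

private

  data Length (xs : List ℕ) (n : ℕ) : Set where
    len : length xs ≡ n → Length xs n

  relen : ∀ {xs m n} → Length xs m → m ≡ n → Length xs n
  relen (len p) q = len (trans p q)

  data Positive? (q : ℕ) : Bool → Set where
    positive? : Positive? q (0 <ᵇ q)

  0<q : ∀ {q} → Positive? q true → 0 < q
  0<q {suc q} positive? = s≤s z≤n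

  data Singleton : List ℕ → Set where
    [-] : ∀ r → Singleton (r ∷ [])

  length-singleton : ∀ {xs} → Singleton xs → length xs ≡ 1
  length-singleton ([-] r) = refl

  n/2≡⌊n/2⌋ : ∀ n → n / 2 ≡ ⌊ n /2⌋
  n/2≡⌊n/2⌋ 0             = refl
  n/2≡⌊n/2⌋ 1             = refl
  n/2≡⌊n/2⌋ (suc (suc n)) =
    trans (m/n≡1+[m∸n]/n {suc (suc n)} {2} (s≤s (s≤s z≤n)))
          (cong suc (n/2≡⌊n/2⌋ n))

  log-small : ∀ k → Positive? (suc k / 2) false → ⌊log₂ suc k ⌋ ≡ 0
  log-small zero    _ = refl
  log-small (suc k) p with suc (suc k) / 2 | n/2≡⌊n/2⌋ (suc (suc k))
  log-small (suc k) () | _ | refl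

  log-big : ∀ k q → q ≡ ⌊ suc k /2⌋ → 0 < q → ⌊log₂ suc k ⌋ ≡ suc ⌊log₂ q ⌋
  log-big (suc k) _ refl _ = cong suc (⌊log2⌋-acc-irrelevant (suc ⌊ k /2⌋))

  -- The worker of toNatDigits is local to it and cannot be named. It is the
  -- function left to inference in the type of length-worker; the call in
  -- length-toNatDigits, where all its arguments are variables, determines it.
  mutual
    length-toNatDigits : ∀ k n →
      (Positive? (suc k / 2) false → 1 ≡ n) →
      (∀ q → q ≡ ⌊ suc k /2⌋ → 0 < q → suc ⌊log₂ q ⌋ + 1 ≡ n) →
      Length (toNatDigits 2 (suc k)) n
    length-toNatDigits k n small big
      with does (0 <? suc k / 2) | positive? {suc k / 2}
    ... | false | p = len (small p)
    ... | true  | p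
      with suc k / 2 | p | n/2≡⌊n/2⌋ (suc k)
         | acc-inverse (<-wellFounded-fast (suc k)) (m/n<m (suc k) 2 sz<ss)
         | suc k % 2 ∷ [] | [-] (suc k % 2)
    ... | q | pos | eq | a | xs | s =
      relen (length-worker k q a xs (0<q pos))
            (trans (cong (suc ⌊log₂ q ⌋ +_) (length-singleton s))
                   (big q eq (0<q pos)))

    length-worker : ∀ k q (a : Acc _<_ q) xs → 0 < q →
                    Length _ (suc ⌊log₂ q ⌋ + length xs)
    length-worker k (suc q) (acc wf) xs _
      with does (0 <? suc q / 2) | positive? {suc q / 2}
    ... | false | p = len (cong (λ l → suc l + length xs) (sym (log-small q p)))
    ... | true  | p =
      relen (length-worker k (suc q / 2) (wf (m/n<m (suc q) 2 sz<ss)) _ (0<q p))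
            (trans (+-suc (suc ⌊log₂ suc q / 2 ⌋) (length xs))
                   (cong (λ l → suc l + length xs)
                         (sym (log-big q _ (n/2≡⌊n/2⌋ (suc q)) (0<q p)))))

numBits≡⌊log₂⌋+1 : ∀ m → numBits m ≡ ⌊log₂ m ⌋ + 1
numBits≡⌊log₂⌋+1 zero    = refl
numBits≡⌊log₂⌋+1 (suc k)
  with length-toNatDigits k (⌊log₂ suc k ⌋ + 1)
         (λ p → cong (_+ 1) (sym (log-small k p)))
         (λ q eq pos → cong (_+ 1) (sym (log-big k q eq pos)))
... | len p = p

{-# OPTIONS --safe #-}
-- Write B m for the central binomial coefficient (2m choose m).  The recurrence
-- (m + 1) B (m + 1) = 2 (2m + 1) B m gives, by induction on m,
--   (2m + 1) (B m)² ≤ 16 ^ m   and   16 ^ m ≤ 4m (B m)²  (m ≥ 1).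
-- For 2m = 2 ^ n and k = ⌊n/2⌋ one has (2 ^ k)² ≤ 2m and 4m ≤ (2 ^ (k + 1))², so
-- taking square roots 2 ^ (2 ^ n - k - 1) ≤ B m < 2 ^ (2 ^ n - k).
module Submission where

open import Defs
open import Data.Nat.Base using (ℕ; _≤_; _∸_; _^_; ⌊_/2⌋)
open import Data.Nat.Base
  using (zero; suc; _+_; _*_; _<_; _!; NonZero; z≤n; s≤s; s≤s⁻¹; ⌈_/2⌉)
open import Data.Nat.Combinatorics using (_C_)
open import Data.Nat.Combinatorics using (nCk≡n!/k![n-k]!; k![n∸k]!∣n!)
open import Data.Nat.DivMod using (m/n*n≡m)
open import Data.Nat.Logarithm
  using (⌊log₂_⌋; ⌊log₂⌋-mono-≤; ⌊log₂⌊n/2⌋⌋≡⌊log₂n⌋∸1; ⌊log₂[2^n]⌋≡n)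
open import Data.Nat.Properties
open import Data.Nat.Tactic.RingSolver using (solve-∀)
open import Relation.Binary.PropositionalEquality using (_≡_)
open import Relation.Binary.PropositionalEquality
  using (sym; trans; cong; subst)

open ≤-Reasoning

-- Central binomial coefficients: recurrence and bounds on their squares

nCk*k![n∸k]!≡n! : ∀ {n k} → k ≤ n → (n C k) * (k ! * (n ∸ k) !) ≡ n !
nCk*k![n∸k]!≡n! {n} {k} k≤n = trans
  (cong (_* (k ! * (n ∸ k) !)) (nCk≡n!/k![n-k]! k≤n))
  (m/n*n≡m (k![n∸k]!∣n! k≤n))
  where instance _ = k !* (n ∸ k) !≢0

centralBinomial : ℕ → ℕ
centralBinomial m = (2 * m) C m

centralBinomial*m!m!≡[2m]! : ∀ m → centralBinomial m * (m ! * m !) ≡ (2 * m) !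
centralBinomial*m!m!≡[2m]! m = subst
  (λ j → centralBinomial m * (m ! * j !) ≡ (2 * m) !)
  -- `2 * m` computes to `m + (m + 0)`, hence the stray `+ 0` in the difference `2 * m ∸ m`.
  (trans (m+n∸m≡n m (m + 0)) (+-identityʳ m))
  (nCk*k![n∸k]!≡n! (m≤m+n m (m + 0)))

centralBinomial≢0 : ∀ m → NonZero (centralBinomial m)
centralBinomial≢0 m = m*n≢0⇒m≢0 (centralBinomial m)
  {{subst NonZero (sym (centralBinomial*m!m!≡[2m]! m)) ((2 * m) !≢0)}}

-- After multiplication by `suc m * (m ! * m !)`, both sides equal `(2 * suc m) !`, so no division
-- is involved.
centralBinomial-suc : ∀ m →
  suc m * centralBinomial (suc m) ≡ 2 * (1 + 2 * m) * centralBinomial m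
centralBinomial-suc m = *-cancelʳ-≡ _ _ (suc m * (m ! * m !)) (begin-equality
  suc m * b′ * (suc m * (m ! * m !))
    ≡⟨ regroup₁ (suc m) b′ (m !) ⟩
  b′ * (suc m ! * suc m !)
    ≡⟨ centralBinomial*m!m!≡[2m]! (suc m) ⟩
  (2 * suc m) !
    -- Once the argument has the form `2 + 2 * m`, the factorial unfolds twice by computation.
    ≡⟨ cong _! (*-suc 2 m) ⟩
  (2 + 2 * m) * ((1 + 2 * m) * (2 * m) !)
    ≡⟨ cong (λ f → (2 + 2 * m) * ((1 + 2 * m) * f)) (centralBinomial*m!m!≡[2m]! m) ⟨
  (2 + 2 * m) * ((1 + 2 * m) * (b * (m ! * m !)))
    ≡⟨ regroup₂ m b (m !) ⟩
  2 * (1 + 2 * m) * b * (suc m * (m ! * m !)) ∎)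
  where
  b  = centralBinomial m
  b′ = centralBinomial (suc m)
  instance
    _ = m !* m !≢0
    _ = m*n≢0 (suc m) (m ! * m !)
  regroup₁ : ∀ s c f → s * c * (s * (f * f)) ≡ c * (s * f * (s * f))
  regroup₁ = solve-∀
  regroup₂ : ∀ m c f → (2 + 2 * m) * ((1 + 2 * m) * (c * (f * f))) ≡
                       2 * (1 + 2 * m) * c * ((1 + m) * (f * f))
  regroup₂ = solve-∀

-- The factor `suc m * suc m` lets the recurrence be applied to both copies of `b′`. The induction
-- step then comes down to (2m + 1)(2m + 3) = 4(m + 1)² - 1 ≤ 4(m + 1)².
centralBinomial-upper : ∀ m →
  (1 + 2 * m) * (centralBinomial m * centralBinomial m) ≤ 4 ^ m * 4 ^ m
centralBinomial-upper zero    = ≤-refl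
centralBinomial-upper (suc m) = *-cancelˡ-≤ (suc m * suc m) (begin
  suc m * suc m * ((1 + 2 * suc m) * (b′ * b′))
    ≡⟨ regroup₁ (suc m) b′ ⟩
  (1 + 2 * suc m) * (suc m * b′ * (suc m * b′))
    ≡⟨ cong (λ x → (1 + 2 * suc m) * (x * x)) (centralBinomial-suc m) ⟩
  (1 + 2 * suc m) * (2 * (1 + 2 * m) * b * (2 * (1 + 2 * m) * b))
    ≡⟨ regroup₂ m b ⟩
  4 * ((1 + 2 * m) * (3 + 2 * m)) * ((1 + 2 * m) * (b * b))
    ≤⟨ *-mono-≤ (*-monoʳ-≤ 4 odd-product) (centralBinomial-upper m) ⟩
  4 * (4 * (suc m * suc m)) * (4 ^ m * 4 ^ m)
    ≡⟨ regroup₃ (suc m) (4 ^ m) ⟩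
  suc m * suc m * (4 ^ suc m * 4 ^ suc m) ∎)
  where
  b  = centralBinomial m
  b′ = centralBinomial (suc m)
  regroup₁ : ∀ s c → s * s * ((1 + 2 * s) * (c * c)) ≡ (1 + 2 * s) * (s * c * (s * c))
  regroup₁ = solve-∀
  regroup₂ : ∀ m c →
    (1 + 2 * (1 + m)) * (2 * (1 + 2 * m) * c * (2 * (1 + 2 * m) * c)) ≡
    4 * ((1 + 2 * m) * (3 + 2 * m)) * ((1 + 2 * m) * (c * c))
  regroup₂ = solve-∀
  regroup₃ : ∀ s p → 4 * (4 * (s * s)) * (p * p) ≡ s * s * (4 * p * (4 * p))
  regroup₃ = solve-∀
  product+1 : ∀ m → 1 + (1 + 2 * m) * (3 + 2 * m) ≡ 4 * ((1 + m) * (1 + m))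
  product+1 = solve-∀
  odd-product : (1 + 2 * m) * (3 + 2 * m) ≤ 4 * (suc m * suc m)
  odd-product = ≤-trans (n≤1+n _) (≤-reflexive (product+1 m))

-- The same scheme, now resting on 4m(m + 1) = (2m + 1)² - 1. The induction starts at m = 1, where
-- both sides are 16; at m = 0 the bound would read 1 ≤ 0.
centralBinomial-lower : ∀ m .{{_ : NonZero m}} →
  4 ^ m * 4 ^ m ≤ 4 * m * (centralBinomial m * centralBinomial m)
centralBinomial-lower (suc zero)      = ≤-refl
centralBinomial-lower (suc m@(suc _)) = *-cancelˡ-≤ (suc m * suc m) (begin
  suc m * suc m * (4 ^ suc m * 4 ^ suc m)
    ≡⟨ regroup₁ (suc m) (4 ^ m) ⟩
  16 * (suc m * suc m) * (4 ^ m * 4 ^ m)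
    ≤⟨ *-monoʳ-≤ (16 * (suc m * suc m)) (centralBinomial-lower m) ⟩
  16 * (suc m * suc m) * (4 * m * (b * b))
    ≡⟨ regroup₂ m (suc m) (b * b) ⟩
  16 * (suc m * (b * b)) * (4 * (m * suc m))
    ≤⟨ *-monoʳ-≤ (16 * (suc m * (b * b))) odd-square ⟩
  16 * (suc m * (b * b)) * ((1 + 2 * m) * (1 + 2 * m))
    ≡⟨ regroup₃ m (suc m) b ⟩
  4 * suc m * (2 * (1 + 2 * m) * b * (2 * (1 + 2 * m) * b))
    ≡⟨ cong (λ x → 4 * suc m * (x * x)) (centralBinomial-suc m) ⟨
  4 * suc m * (suc m * b′ * (suc m * b′))
    ≡⟨ regroup₄ (suc m) b′ ⟩
  suc m * suc m * (4 * suc m * (b′ * b′)) ∎)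
  where
  b  = centralBinomial m
  b′ = centralBinomial (suc m)
  regroup₁ : ∀ s p → s * s * (4 * p * (4 * p)) ≡ 16 * (s * s) * (p * p)
  regroup₁ = solve-∀
  regroup₂ : ∀ m s c → 16 * (s * s) * (4 * m * c) ≡ 16 * (s * c) * (4 * (m * s))
  regroup₂ = solve-∀
  regroup₃ : ∀ m s c → 16 * (s * (c * c)) * ((1 + 2 * m) * (1 + 2 * m)) ≡
                       4 * s * (2 * (1 + 2 * m) * c * (2 * (1 + 2 * m) * c))
  regroup₃ = solve-∀
  regroup₄ : ∀ s c → 4 * s * (s * c * (s * c)) ≡ s * s * (4 * s * (c * c))
  regroup₄ = solve-∀
  product+1 : ∀ m → 1 + 4 * (m * (1 + m)) ≡ (1 + 2 * m) * (1 + 2 * m)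
  product+1 = solve-∀
  odd-square : 4 * (m * suc m) ≤ (1 + 2 * m) * (1 + 2 * m)
  odd-square = ≤-trans (n≤1+n _) (≤-reflexive (product+1 m))

-- Square roots and powers of two

m*m≤n*n⇒m≤n : ∀ {m n} → m * m ≤ n * n → m ≤ n
m*m≤n*n⇒m≤n m²≤n² = ≮⇒≥ (λ n<m → <⇒≱ (*-mono-< n<m n<m) m²≤n²)

m*m<n*n⇒m<n : ∀ {m n} → m * m < n * n → m < n
m*m<n*n⇒m<n m²<n² = ≰⇒> (λ n≤m → ≤⇒≯ (*-mono-≤ n≤m n≤m) m²<n²)

n<2^n : ∀ n → n < 2 ^ n
n<2^n zero    = s≤s z≤n
n<2^n (suc n) = begin-strict
  suc n         ≤⟨ n<2^n n ⟩
  2 ^ n         <⟨ m<m+n (2 ^ n) (m^n>0 2 n) ⟩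
  2 ^ n + 2 ^ n ≡⟨ cong (2 ^ n +_) (+-identityʳ (2 ^ n)) ⟨
  2 ^ suc n     ∎

[2^⌊n/2⌋]²≤2^n : ∀ n → 2 ^ ⌊ n /2⌋ * 2 ^ ⌊ n /2⌋ ≤ 2 ^ n
[2^⌊n/2⌋]²≤2^n n = begin
  2 ^ k * 2 ^ k     ≡⟨ ^-distribˡ-+-* 2 k k ⟨
  2 ^ (k + k)       ≤⟨ ^-monoʳ-≤ 2 (+-monoʳ-≤ k (⌊n/2⌋≤⌈n/2⌉ n)) ⟩
  2 ^ (k + ⌈ n /2⌉) ≡⟨ cong (2 ^_) (⌊n/2⌋+⌈n/2⌉≡n n) ⟩
  2 ^ n             ∎
  where k = ⌊ n /2⌋

2^[1+n]≤[2^[1+⌊n/2⌋]]² : ∀ n → 2 ^ suc n ≤ 2 ^ suc ⌊ n /2⌋ * 2 ^ suc ⌊ n /2⌋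
2^[1+n]≤[2^[1+⌊n/2⌋]]² n = begin
  2 ^ suc n               ≡⟨ cong (λ j → 2 ^ suc j) (⌊n/2⌋+⌈n/2⌉≡n n) ⟨
  -- `⌈ n /2⌉` is `⌊ suc n /2⌋` and `suc k` is `⌊ 2 + n /2⌋`, so monotonicity of halving compares
  -- them.
  2 ^ (suc k + ⌈ n /2⌉)   ≤⟨ ^-monoʳ-≤ 2 (+-monoʳ-≤ (suc k) (⌊n/2⌋-mono (n≤1+n (suc n)))) ⟩
  2 ^ (suc k + suc k)     ≡⟨ ^-distribˡ-+-* 2 (suc k) (suc k) ⟩
  2 ^ suc k * 2 ^ suc k   ∎
  where k = ⌊ n /2⌋

m<2*n⇒⌊m/2⌋<n : ∀ {m n} → m < 2 * n → ⌊ m /2⌋ < n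
m<2*n⇒⌊m/2⌋<n {m} {n} m<2n = *-cancelˡ-< 2 ⌊ m /2⌋ n (begin-strict
  2 * ⌊ m /2⌋           ≡⟨ cong (⌊ m /2⌋ +_) (+-identityʳ ⌊ m /2⌋) ⟩
  ⌊ m /2⌋ + ⌊ m /2⌋     ≤⟨ +-monoʳ-≤ ⌊ m /2⌋ (⌊n/2⌋≤⌈n/2⌉ m) ⟩
  ⌊ m /2⌋ + ⌈ m /2⌉     ≡⟨ ⌊n/2⌋+⌈n/2⌉≡n m ⟩
  m                     <⟨ m<2n ⟩
  2 * n                 ∎)

-- Halving `m` lowers both the exponent of the bound and the logarithm by one.
m<2^[1+n]⇒⌊log₂m⌋≤n : ∀ {m} n → m < 2 ^ suc n → ⌊log₂ m ⌋ ≤ n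
m<2^[1+n]⇒⌊log₂m⌋≤n     zero    m<2     = ⌊log₂⌋-mono-≤ (s≤s⁻¹ m<2)
m<2^[1+n]⇒⌊log₂m⌋≤n {m} (suc n) m<2^2+n = begin
  -- Only an inequality, since the subtraction truncates when the logarithm is 0.
  ⌊log₂ m ⌋               ≤⟨ m≤n+m∸n ⌊log₂ m ⌋ 1 ⟩
  suc (⌊log₂ m ⌋ ∸ 1)     ≡⟨ cong suc (⌊log₂⌊n/2⌋⌋≡⌊log₂n⌋∸1 m) ⟨
  suc ⌊log₂ ⌊ m /2⌋ ⌋     ≤⟨ s≤s (m<2^[1+n]⇒⌊log₂m⌋≤n n (m<2*n⇒⌊m/2⌋<n m<2^2+n)) ⟩
  suc n                   ∎

numBits-unique : ∀ {m} n → 2 ^ n ≤ m → m < 2 ^ suc n → numBits m ≡ suc n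
numBits-unique {m} n 2^n≤m m<2^[1+n] = begin-equality
  numBits m       ≡⟨ numBits≡⌊log₂⌋+1 m ⟩
  ⌊log₂ m ⌋ + 1   ≡⟨ +-comm ⌊log₂ m ⌋ 1 ⟩
  suc ⌊log₂ m ⌋   ≡⟨ cong suc (≤-antisym
                       (m<2^[1+n]⇒⌊log₂m⌋≤n n m<2^[1+n])
                       (subst (_≤ ⌊log₂ m ⌋) (⌊log₂[2^n]⌋≡n n) (⌊log₂⌋-mono-≤ 2^n≤m))) ⟩
  suc n           ∎

-- Enclosing the coefficient between consecutive powers of two

2^k*centralBinomial<2^[2m] : ∀ m k → 2 ^ k * 2 ^ k ≤ 2 * m →
  2 ^ k * centralBinomial m < 2 ^ (2 * m)
2^k*centralBinomial<2^[2m] m k 2^k*2^k≤2m = m*m<n*n⇒m<n (begin-strict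
  2 ^ k * b * (2 ^ k * b)     ≡⟨ [m*n]*[o*p]≡[m*o]*[n*p] (2 ^ k) b (2 ^ k) b ⟩
  2 ^ k * 2 ^ k * (b * b)     ≤⟨ *-monoˡ-≤ (b * b) 2^k*2^k≤2m ⟩
  -- Strictness comes from 2m < 2m + 1, multiplied by the nonzero `b * b`.
  2 * m * (b * b)             <⟨ *-monoˡ-< (b * b) (n<1+n (2 * m)) ⟩
  (1 + 2 * m) * (b * b)       ≤⟨ centralBinomial-upper m ⟩
  4 ^ m * 4 ^ m               ≡⟨ cong (λ x → x * x) (^-*-assoc 2 2 m) ⟩
  2 ^ (2 * m) * 2 ^ (2 * m)   ∎)
  where
  b = centralBinomial m
  instance
    _ = centralBinomial≢0 m
    _ = m*n≢0 b b

2^[2m]≤2^k*centralBinomial : ∀ m .{{_ : NonZero m}} k → 4 * m ≤ 2 ^ k * 2 ^ k →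
  2 ^ (2 * m) ≤ 2 ^ k * centralBinomial m
2^[2m]≤2^k*centralBinomial m k 4m≤2^k*2^k = m*m≤n*n⇒m≤n (begin
  2 ^ (2 * m) * 2 ^ (2 * m)   ≡⟨ cong (λ x → x * x) (^-*-assoc 2 2 m) ⟨
  4 ^ m * 4 ^ m               ≤⟨ centralBinomial-lower m ⟩
  4 * m * (b * b)             ≤⟨ *-monoˡ-≤ (b * b) 4m≤2^k*2^k ⟩
  2 ^ k * 2 ^ k * (b * b)     ≡⟨ [m*n]*[o*p]≡[m*o]*[n*p] (2 ^ k) b (2 ^ k) b ⟨
  2 ^ k * b * (2 ^ k * b)     ∎)
  where b = centralBinomial m

theorem1 : (n : ℕ) → 1 ≤ n → numBits ((2 ^ n) C (2 ^ (n ∸ 1))) ≡ 2 ^ n ∸ ⌊ n /2⌋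
theorem1 n@(suc l) _ = trans (numBits-unique a 2^a≤b b<2^[1+a]) 1+a≡N∸k
  where
  m = 2 ^ l
  N = 2 ^ n
  k = ⌊ n /2⌋
  -- The intended value of `⌊log₂ b ⌋`, one less than the number of bits.
  a = N ∸ suc k
  -- `2 ^ suc l` computes to `2 * 2 ^ l`, so `2 * m` is `N` and `b` is the coefficient in the
  -- statement.
  b = centralBinomial m
  instance
    _ = m^n≢0 2 l
    _ = m^n≢0 2 (suc k)

  -- Makes the truncated subtraction in `a` exact; it follows from k ≤ n < 2 ^ n.
  1+k≤N : suc k ≤ N
  1+k≤N = ≤-trans (s≤s (⌊n/2⌋≤n n)) (n<2^n n)

  1+a≡N∸k : suc a ≡ N ∸ k
  1+a≡N∸k = sym (+-∸-assoc 1 1+k≤N)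

  2^a≤b : 2 ^ a ≤ b
  -- Multiplying by `2 ^ suc k` clears the subtraction from the exponent; for the upper bound
  -- `2 ^ k` does this, as the exponent there is `suc a`.
  2^a≤b = *-cancelˡ-≤ (2 ^ suc k) (begin
    2 ^ suc k * 2 ^ a   ≡⟨ ^-distribˡ-+-* 2 (suc k) a ⟨
    2 ^ (suc k + a)     ≡⟨ cong (2 ^_) (m+[n∸m]≡n 1+k≤N) ⟩
    2 ^ N               ≤⟨ 2^[2m]≤2^k*centralBinomial m (suc k) 4m≤ ⟩
    2 ^ suc k * b       ∎)
    where
    4m≤ : 4 * m ≤ 2 ^ suc k * 2 ^ suc k
    4m≤ = ≤-trans (≤-reflexive (*-assoc 2 2 m)) (2^[1+n]≤[2^[1+⌊n/2⌋]]² n)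

  b<2^[1+a] : b < 2 ^ suc a
  b<2^[1+a] = *-cancelˡ-< (2 ^ k) _ _ (begin-strict
    2 ^ k * b           <⟨ 2^k*centralBinomial<2^[2m] m k ([2^⌊n/2⌋]²≤2^n n) ⟩
    2 ^ N               ≡⟨ cong (2 ^_) (m+[n∸m]≡n 1+k≤N) ⟨
    2 ^ (suc k + a)     ≡⟨ cong (2 ^_) (+-suc k a) ⟨
    2 ^ (k + suc a)     ≡⟨ ^-distribˡ-+-* 2 k (suc a) ⟩
    2 ^ k * 2 ^ suc a   ∎)
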